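{- Let $C$ be a $d$-dimensional smooth combinatorial cube in $\mathbb{R}^d$ with $d \geq 2$. Then $C$ has two (distinct) parallel facets.
   Context: A $d$-dimensional combinatorial cube is a polytope whose face poset is isomorphic to the face poset of $[0,1]^d$. A $d$-dimensional polytope in $\mathbb{R}^d$ is smooth if it is a lattice polytope, each vertex lies on exactly $d$ edges, and the primitive edge directions (smallest lattice vectors along the incident edges) at each vertex form a basis of $\mathbb{Z}^d$. For a face $F$, $\mathrm{lin}(F)$ denotes the linear subspace parallel to the affine hull of $F$; two faces $F,G$ are parallel if $\mathrm{lin}(F)=\mathrm{lin}(G)$. -}

module Defs where

open import Data.Nat using (ℕ; zero; suc; _≥_)
open import Data.Integer as ℤ using (ℤ; _+_; _*_; _-_; _≤_; 0ℤ; 1ℤ; +_)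
open import Data.Fin using (Fin; zero; suc)
open import Data.Fin.Subset using (Subset; _∈_; _∉_; _⊆_; ⊤; ⁅_⁆; _∪_; ∣_∣)
open import Data.Vec using (Vec; []; _∷_; zipWith; replicate; map; lookup)
open import Data.List using (List; []; _∷_; _++_; length)
import Data.List as L
open import Data.Product using (Σ; ∃; ∃-syntax; _×_; _,_; proj₁)
open import Data.Sum using (_⊎_)
open import Function using (_⇔_)
open import Function.Definitions using (Injective)
open import Relation.Binary.PropositionalEquality using (_≡_; _≢_)
open import Relation.Nullary using (¬_)

Pt : ℕ → Set
Pt d = Vec ℤ d

_⊕_ : ∀ {d} → Pt d → Pt d → Pt d
_⊕_ = zipWith _+_

_⊖_ : ∀ {d} → Pt d → Pt d → Pt d
_⊖_ = zipWith _-_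

_•_ : ∀ {d} → ℤ → Pt d → Pt d
k • v = map (k *_) v

𝟘 : ∀ {d} → Pt d
𝟘 = replicate _ 0ℤ

dot : ∀ {d} → Pt d → Pt d → ℤ
dot [] [] = 0ℤ
dot (x ∷ xs) (y ∷ ys) = x * y + dot xs ys

sumℤ : ∀ {n} → (Fin n → ℤ) → ℤ
sumℤ {zero} f = 0ℤ
sumℤ {suc n} f = f zero + sumℤ (λ i → f (suc i))

vsum : ∀ {n d} → (Fin n → Pt d) → Pt d
vsum {zero} f = 𝟘
vsum {suc n} f = f zero ⊕ vsum (λ i → f (suc i))

-- A lattice polytope P = conv {v 0, …, v (n-1)} ⊆ ℝ^d, given by a finite
-- list of integer points.  Faces are recorded by the set of indices of the
-- points they contain.  A (nonempty) face is the set of points maximising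
-- some linear functional c; since the points are integral, every face is
-- exposed by a rational, hence (after scaling) an integral, functional.

record PointConfig (d : ℕ) : Set where
  constructor conf
  field
    n : ℕ
    v : Fin n → Pt d
open PointConfig public

IsFace : ∀ {d} (P : PointConfig d) → Subset (n P) → Set
IsFace P F = ∃[ c ] (∀ i → (i ∈ F ⇔ (∀ j → dot c (v P j) ≤ dot c (v P i))))

Face : ∀ {d} → PointConfig d → Set
Face P = Σ (Subset (n P)) (IsFace P)

AllVertices : ∀ {d} → PointConfig d → Set
AllVertices P = ∀ i → IsFace P ⁅ i ⁆

record FacePosetIso {d e} (P : PointConfig d) (Q : PointConfig e) : Set where
  field
    to      : Face P → Face Q
    from    : Face Q → Face P
    from∘to : ∀ F → proj₁ (from (to F)) ≡ proj₁ F
    to∘from : ∀ G → proj₁ (to (from G)) ≡ proj₁ G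
    mono    : ∀ F G → (proj₁ F ⊆ proj₁ G ⇔ proj₁ (to F) ⊆ proj₁ (to G))

cubeList : (d : ℕ) → List (Pt d)
cubeList zero = [] ∷ []
cubeList (suc d) = L.map (0ℤ ∷_) (cubeList d) ++ L.map (1ℤ ∷_) (cubeList d)

Cube : (d : ℕ) → PointConfig d
Cube d = conf (length (cubeList d)) (L.lookup (cubeList d))

IsCombinatorialCube : ∀ {d} → PointConfig d → Set
IsCombinatorialCube {d} P = FacePosetIso P (Cube d)

Adjacent : ∀ {d} (P : PointConfig d) → Fin (n P) → Fin (n P) → Set
Adjacent P i j = IsFace P (⁅ i ⁆ ∪ ⁅ j ⁆) × ∣ ⁅ i ⁆ ∪ ⁅ j ⁆ ∣ ≡ 2

IsFacet : ∀ {d} (P : PointConfig d) → Subset (n P) → Set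
IsFacet P F = IsFace P F × F ≢ ⊤ ×
  (∀ G → IsFace P G → F ⊆ G → G ≡ F ⊎ G ≡ ⊤)

IsPrimitiveDir : ∀ {d} → Pt d → Pt d → Set
IsPrimitiveDir {d} w p =
  (Σ ℕ λ m → (m ≥ 1 × w ≡ (+ m) • p)) ×
  (∀ (q : Pt d) (m : ℕ) → m ≥ 1 → p ≡ (+ m) • q → m ≡ 1)

IsLatticeBasis : ∀ {d} → (Fin d → Pt d) → Set
IsLatticeBasis {d} u =
  (∀ (w : Pt d) → Σ (Fin d → ℤ) λ a → (vsum {d} {d} (λ k → a k • u k) ≡ w)) ×
  (∀ (a : Fin d → ℤ) → vsum {d} {d} (λ k → a k • u k) ≡ 𝟘 → ∀ k → a k ≡ 0ℤ)

IsSmooth : ∀ {d} → PointConfig d → Set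
IsSmooth {d} P = ∀ i → ∃[ nb ] ∃[ u ]
  ( Injective _≡_ _≡_ nb
  × (∀ j → (Adjacent P i j ⇔ (∃[ k ] (nb k ≡ j))))
  × (∀ k → IsPrimitiveDir (v P (nb k) ⊖ v P i) (u k))
  × IsLatticeBasis {d} u )

InLin : ∀ {d} (P : PointConfig d) → Subset (n P) → Pt d → Set
InLin P F w = ∃[ k ] (k ≢ 0ℤ × ∃[ λc ]
  ( (∀ i → i ∉ F → λc i ≡ 0ℤ)
  × sumℤ λc ≡ 0ℤ
  × k • w ≡ vsum (λ i → λc i • v P i)))

LinSub : ∀ {d} (P : PointConfig d) → Subset (n P) → Subset (n P) → Set
LinSub P F G = ∀ i j → i ∈ F → j ∈ F → InLin P G (v P i ⊖ v P j)

Parallel : ∀ {d} (P : PointConfig d) → Subset (n P) → Subset (n P) → Set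
Parallel P F G = LinSub P F G × LinSub P G F

{-# OPTIONS --safe #-}

-- Label the vertices of the cube by x ∈ {0,1}^d.  Let u(x,i) be the primitive direction of the edge
-- leaving x in direction i, and let h(i,ε) be the primitive inner normal of the facet x_i = ε, so that
-- h(i,x_i) · u(x,j) = δ_ij.  Put a_x(i,j) = h(i,1-x_i) · u(x,j).  Smoothness gives a_x(i,i) = -1,
-- and walking along the edge in direction i pivots the matrix:
--   a_{x^i}(k,j) = a_x(k,j) + a_x(i,j) a_x(k,i)   for j, k ≠ i,
-- where x^i is x with its i-th coordinate changed.  These two properties force every principal
-- submatrix of a_x to have a row which is zero off the diagonal.  If row i of a_x is such a row,
-- then h(i,1) = -h(i,0), so the facets x_i = 0 and x_i = 1 are parallel.

module Submission where

open import Defs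
open import Data.Bool using (Bool; true; false; not; if_then_else_)
import Data.Bool.Properties as Bool
open import Data.Empty using (⊥; ⊥-elim)
open import Data.Fin using (Fin; zero; suc; _≟_; punchIn; punchOut)
open import Data.Fin.Properties using (punchIn-injective; punchInᵢ≢i; punchIn-punchOut; punchOut-injective; injective⇒≤; any?; all?; suc-injective)
open import Data.Fin.Subset using (Subset; _∈_; _∉_; _⊆_; ⊤; ⁅_⁆; _∪_; ∣_∣)
open import Data.Fin.Subset.Properties using (x∈⁅x⁆; x∈⁅y⁆⇒x≡y; ⊆-antisym; ∈⊤; x∈p∪q⁺; x∈p∪q⁻; _∈?_; ∪-identityˡ; ∪-identityʳ; ∣⁅x⁆∣≡1)
open import Data.Integer using (ℤ; _+_; _*_; _-_; -_; _≤_; _<_; 0ℤ; 1ℤ; -1ℤ; -[1+_]; +≤+; -≤+; -<+; +<+; NonZero; ≢-nonZero) renaming (+_ to pos)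
import Data.Integer.Properties as ℤ
open import Data.Integer.Divisibility.Signed using (_∣_; divides; ∣⇒∣ᵤ; ∣m∣n⇒∣m+n; ∣n⇒∣m*n; ∣-refl)
open import Data.Integer.Tactic.RingSolver using (solve-∀)
import Data.List as L
open import Data.List.Membership.Propositional using () renaming (_∈_ to _∈ₗ_)
open import Data.List.Membership.Propositional.Properties using (∈-map⁺; ∈-map⁻; ∈-++⁺ˡ; ∈-++⁺ʳ; ∈-++⁻; ∈-lookup)
open import Data.List.Relation.Unary.Any using (index; here)
open import Data.List.Relation.Unary.Any.Properties using (lookup-index)
open import Data.Nat using (ℕ; zero; suc; _≥_; z≤n)
import Data.Nat.Divisibility as ℕ
import Data.Nat.Properties as ℕ
open import Data.Product using (∃; ∃-syntax; _×_; _,_; proj₁; proj₂)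
open import Data.Sum using (_⊎_; inj₁; inj₂)
open import Data.Unit using (tt) renaming (⊤ to 𝟙)
open import Data.Vec using (Vec; []; _∷_; lookup; map; replicate; tabulate; tail; updateAt)
open import Data.Vec.Properties using (lookup∘tabulate; lookup∘updateAt; lookup∘updateAt′; tabulate∘lookup; tabulate-cong; []=⇒lookup; lookup⇒[]=; lookup-replicate)
open import Function using (_∘_; _⇔_; mk⇔; Equivalence)
open import Function.Definitions using (Injective)
open import Relation.Binary.PropositionalEquality using (_≡_; _≢_; refl; sym; trans; cong; cong₂; subst; subst₂; module ≡-Reasoning)
open import Relation.Nullary using (¬_; Dec; yes; no; does; contradiction)
open import Relation.Nullary.Decidable using (¬?; _→-dec_; _×-dec_; decidable-stable; dec-true)
open import Relation.Unary using (Decidable)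

open ≡-Reasoning

*-≡0 : ∀ {s t} → s ≢ 0ℤ → s * t ≡ 0ℤ → t ≡ 0ℤ
*-≡0 {s} s≢0 st≡0 with ℤ.i*j≡0⇒i≡0∨j≡0 s st≡0
... | inj₁ s≡0 = contradiction s≡0 s≢0
... | inj₂ t≡0 = t≡0

*-≢0 : ∀ {a b} → a ≢ 0ℤ → b ≢ 0ℤ → a * b ≢ 0ℤ
*-≢0 {a} a≢0 b≢0 ab≡0 with ℤ.i*j≡0⇒i≡0∨j≡0 a ab≡0
... | inj₁ a≡0 = a≢0 a≡0
... | inj₂ b≡0 = b≢0 b≡0

-- Finite sums

sum-cong : ∀ {n} {f g : Fin n → ℤ} → (∀ k → f k ≡ g k) → sumℤ f ≡ sumℤ g
sum-cong {zero}  f≗g = refl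
sum-cong {suc n} f≗g = cong₂ _+_ (f≗g zero) (sum-cong (f≗g ∘ suc))

sum-zero : ∀ {n} {f : Fin n → ℤ} → (∀ k → f k ≡ 0ℤ) → sumℤ f ≡ 0ℤ
sum-zero {zero}  f≗0 = refl
sum-zero {suc n} f≗0 = cong₂ _+_ (f≗0 zero) (sum-zero (f≗0 ∘ suc))

sum-+ : ∀ {n} (f g : Fin n → ℤ) → sumℤ (λ k → f k + g k) ≡ sumℤ f + sumℤ g
sum-+ {zero}  f g = refl
sum-+ {suc n} f g = trans (cong ((f zero + g zero) +_) (sum-+ (f ∘ suc) (g ∘ suc)))
  (interchange (f zero) (g zero) (sumℤ (f ∘ suc)) (sumℤ (g ∘ suc)))
  where
  interchange : ∀ a b c d → (a + b) + (c + d) ≡ (a + c) + (b + d)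
  interchange = solve-∀

sum-* : ∀ {n} a (f : Fin n → ℤ) → sumℤ (λ k → a * f k) ≡ a * sumℤ f
sum-* {zero}  a f = sym (ℤ.*-zeroʳ a)
sum-* {suc n} a f = trans (cong ((a * f zero) +_) (sum-* a (f ∘ suc)))
  (sym (ℤ.*-distribˡ-+ a (f zero) _))

sum-one : ∀ {n} {f : Fin n → ℤ} i → (∀ k → k ≢ i → f k ≡ 0ℤ) → sumℤ f ≡ f i
sum-one {f = f} zero off =
  trans (cong (f zero +_) (sum-zero (λ k → off (suc k) λ ()))) (ℤ.+-identityʳ (f zero))
sum-one {f = f} (suc i) off =
  trans (cong₂ _+_ (off zero λ ()) (sum-one i (λ k k≢i → off (suc k) (k≢i ∘ suc-injective))))
    (ℤ.+-identityˡ (f (suc i)))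

sum-two : ∀ {n} {f : Fin n → ℤ} {i j} → i ≢ j →
  (∀ k → k ≢ i → k ≢ j → f k ≡ 0ℤ) → sumℤ f ≡ f i + f j
sum-two {i = zero}  {zero}  i≢j off = contradiction refl i≢j
sum-two {f = f} {zero}  {suc j} i≢j off =
  cong (f zero +_) (sum-one j λ k k≢j → off (suc k) (λ ()) (k≢j ∘ suc-injective))
sum-two {f = f} {suc i} {zero}  i≢j off =
  trans (cong (f zero +_) (sum-one i λ k k≢i → off (suc k) (k≢i ∘ suc-injective) λ ()))
    (ℤ.+-comm (f zero) (f (suc i)))
sum-two {i = suc i} {suc j} i≢j off =
  trans (cong₂ _+_ (off zero (λ ()) (λ ()))
      (sum-two (i≢j ∘ cong suc) λ k k≢i k≢j →
        off (suc k) (k≢i ∘ suc-injective) (k≢j ∘ suc-injective)))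
    (ℤ.+-identityˡ _)

-- Linear functionals

dot-⊕ : ∀ {d} (g a b : Pt d) → dot g (a ⊕ b) ≡ dot g a + dot g b
dot-⊕ [] [] [] = refl
dot-⊕ (x ∷ g) (y ∷ a) (z ∷ b) = trans (cong ((x * (y + z)) +_) (dot-⊕ g a b)) (law x y z (dot g a) (dot g b))
  where
  law : ∀ x y z s t → x * (y + z) + (s + t) ≡ (x * y + s) + (x * z + t)
  law = solve-∀

dot-⊖ : ∀ {d} (g a b : Pt d) → dot g (a ⊖ b) ≡ dot g a - dot g b
dot-⊖ [] [] [] = refl
dot-⊖ (x ∷ g) (y ∷ a) (z ∷ b) = trans (cong ((x * (y - z)) +_) (dot-⊖ g a b)) (law x y z (dot g a) (dot g b))
  where
  law : ∀ x y z s t → x * (y - z) + (s - t) ≡ (x * y + s) - (x * z + t)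
  law = solve-∀

dot-• : ∀ {d} (g : Pt d) k a → dot g (k • a) ≡ k * dot g a
dot-• [] k [] = sym (ℤ.*-zeroʳ k)
dot-• (x ∷ g) k (y ∷ a) = trans (cong ((x * (k * y)) +_) (dot-• g k a)) (law x k y (dot g a))
  where
  law : ∀ x k y s → x * (k * y) + k * s ≡ k * (x * y + s)
  law = solve-∀

dot-𝟘 : ∀ {d} (g : Pt d) → dot g 𝟘 ≡ 0ℤ
dot-𝟘 [] = refl
dot-𝟘 (x ∷ g) = cong₂ _+_ (ℤ.*-zeroʳ x) (dot-𝟘 g)

𝟘-dot : ∀ {d} (a : Pt d) → dot 𝟘 a ≡ 0ℤ
𝟘-dot [] = refl
𝟘-dot (x ∷ a) = cong₂ _+_ (ℤ.*-zeroˡ x) (𝟘-dot a)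

dot-vsum : ∀ {d n} (g : Pt d) (f : Fin n → Pt d) → dot g (vsum f) ≡ sumℤ (λ k → dot g (f k))
dot-vsum {n = zero}  g f = dot-𝟘 g
dot-vsum {n = suc n} g f =
  trans (dot-⊕ g (f zero) _) (cong (dot g (f zero) +_) (dot-vsum g (f ∘ suc)))

dot-lincomb : ∀ {d n} (g : Pt d) (a : Fin n → ℤ) (f : Fin n → Pt d) →
  dot g (vsum (λ k → a k • f k)) ≡ sumℤ (λ k → a k * dot g (f k))
dot-lincomb g a f = trans (dot-vsum g (λ k → a k • f k)) (sum-cong λ k → dot-• g (a k) (f k))

dot-ext : ∀ {d} {a b : Pt d} → (∀ g → dot g a ≡ dot g b) → a ≡ b
dot-ext {a = []} {[]} _ = refl
dot-ext {a = x ∷ a} {y ∷ b} eq =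
  cong₂ _∷_ (trans (sym (dot-head x a)) (trans (eq (1ℤ ∷ 𝟘)) (dot-head y b)))
            (dot-ext λ g → trans (sym (dot-tail x a g)) (trans (eq (0ℤ ∷ g)) (dot-tail y b g)))
  where
  dot-head : ∀ z c → dot (1ℤ ∷ 𝟘) (z ∷ c) ≡ z
  dot-head z c = trans (cong₂ _+_ (ℤ.*-identityˡ z) (𝟘-dot c)) (ℤ.+-identityʳ z)
  dot-tail : ∀ z c g → dot (0ℤ ∷ g) (z ∷ c) ≡ dot g c
  dot-tail z c g = trans (cong (_+ dot g c) (ℤ.*-zeroˡ z)) (ℤ.+-identityˡ _)

divide-functional : ∀ {d} (c : Pt d) μ → (∀ w → μ ∣ dot c w) →
  ∃[ h ] (∀ w → dot c w ≡ μ * dot h w)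
divide-functional [] μ _ = [] , λ { [] → sym (ℤ.*-zeroʳ μ) }
divide-functional (x ∷ c) μ μ∣ with μ∣ (1ℤ ∷ 𝟘) | divide-functional c μ
    (λ w → subst (μ ∣_) (trans (cong (_+ dot c w) (ℤ.*-zeroʳ x)) (ℤ.+-identityˡ _)) (μ∣ (0ℤ ∷ w)))
... | divides q eq | h , c≡μh = q ∷ h , λ { (y ∷ w) →
    trans (cong₂ _+_ (cong (_* y) x≡) (c≡μh w)) (law q μ y _) }
  where
  x≡ : x ≡ q * μ
  x≡ = trans (sym (trans (cong₂ _+_ (ℤ.*-identityʳ x) (dot-𝟘 c)) (ℤ.+-identityʳ x))) eq
  law : ∀ q μ y s → q * μ * y + μ * s ≡ μ * (q * y + s)
  law = solve-∀

vsum-closed : ∀ {d n} (R : Pt d → Set) → R 𝟘 → (∀ {a b} → R a → R b → R (a ⊕ b)) →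
  (f : Fin n → Pt d) → (∀ k → R (f k)) → R (vsum f)
vsum-closed {n = zero}  R R𝟘 R⊕ f Rf = R𝟘
vsum-closed {n = suc n} R R𝟘 R⊕ f Rf = R⊕ (Rf zero) (vsum-closed R R𝟘 R⊕ (f ∘ suc) (Rf ∘ suc))

-- Directions of a face

module _ {d} (P : PointConfig d) (F : Subset (n P)) where

  InLin-𝟘 : InLin P F 𝟘
  InLin-𝟘 = 1ℤ , (λ ()) , (λ _ → 0ℤ) , (λ _ _ → refl) , sum-zero {n P} (λ _ → refl) ,
    dot-ext λ g → begin
      dot g (1ℤ • 𝟘)                       ≡⟨ dot-• g 1ℤ 𝟘 ⟩
      1ℤ * dot g 𝟘                         ≡⟨ cong (1ℤ *_) (dot-𝟘 g) ⟩
      0ℤ                                   ≡⟨ sum-zero (λ k → ℤ.*-zeroˡ (dot g (v P k))) ⟨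
      sumℤ (λ k → 0ℤ * dot g (v P k))      ≡⟨ dot-lincomb g (λ _ → 0ℤ) (v P) ⟨
      dot g (vsum (λ k → 0ℤ • v P k))      ∎

  InLin-⊕ : ∀ {a b} → InLin P F a → InLin P F b → InLin P F (a ⊕ b)
  InLin-⊕ {a} {b} (k , k≢0 , λa , offa , suma , eqa) (l , l≢0 , λb , offb , sumb , eqb) =
    k * l , *-≢0 k≢0 l≢0 , (λ i → l * λa i + k * λb i) ,
    (λ i i∉F → trans (cong₂ (λ s t → l * s + k * t) (offa i i∉F) (offb i i∉F)) (law₀ k l)) ,
    trans (combine λa λb) (trans (cong₂ (λ s t → l * s + k * t) suma sumb) (law₀ k l)) ,
    dot-ext λ g → begin
      dot g ((k * l) • (a ⊕ b))                 ≡⟨ dot-• g (k * l) (a ⊕ b) ⟩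
      (k * l) * dot g (a ⊕ b)                   ≡⟨ cong ((k * l) *_) (dot-⊕ g a b) ⟩
      (k * l) * (dot g a + dot g b)             ≡⟨ law₁ k l (dot g a) (dot g b) ⟩
      l * (k * dot g a) + k * (l * dot g b)     ≡⟨ cong₂ (λ s t → l * s + k * t) (via g a k λa eqa) (via g b l λb eqb) ⟩
      l * sumℤ (λ i → λa i * dot g (v P i)) + k * sumℤ (λ i → λb i * dot g (v P i))
        ≡⟨ combine (λ i → λa i * dot g (v P i)) (λ i → λb i * dot g (v P i)) ⟨
      sumℤ (λ i → l * (λa i * dot g (v P i)) + k * (λb i * dot g (v P i)))
        ≡⟨ sum-cong (λ i → law₂ k l (λa i) (λb i) (dot g (v P i))) ⟩
      sumℤ (λ i → (l * λa i + k * λb i) * dot g (v P i)) ≡⟨ dot-lincomb g (λ i → l * λa i + k * λb i) (v P) ⟨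
      dot g (vsum (λ i → (l * λa i + k * λb i) • v P i)) ∎
    where
    law₀ : ∀ k l → l * 0ℤ + k * 0ℤ ≡ 0ℤ
    law₀ = solve-∀
    law₁ : ∀ k l s t → (k * l) * (s + t) ≡ l * (k * s) + k * (l * t)
    law₁ = solve-∀
    law₂ : ∀ k l x y s → l * (x * s) + k * (y * s) ≡ (l * x + k * y) * s
    law₂ = solve-∀
    combine : ∀ f f′ → sumℤ (λ i → l * f i + k * f′ i) ≡ l * sumℤ {n P} f + k * sumℤ f′
    combine f f′ = trans (sum-+ (λ i → l * f i) (λ i → k * f′ i)) (cong₂ _+_ (sum-* l f) (sum-* k f′))
    via : ∀ g w m μ → m • w ≡ vsum (λ i → μ i • v P i) →
      m * dot g w ≡ sumℤ (λ i → μ i * dot g (v P i))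
    via g w m μ eq = trans (sym (dot-• g m w)) (trans (cong (dot g) eq) (dot-lincomb g μ (v P)))

  InLin-• : ∀ a {w} → InLin P F w → InLin P F (a • w)
  InLin-• a {w} (k , k≢0 , μ , off , sum≡0 , eq) =
    k , k≢0 , (λ i → a * μ i) ,
    (λ i i∉F → trans (cong (a *_) (off i i∉F)) (ℤ.*-zeroʳ a)) ,
    trans (sum-* a μ) (trans (cong (a *_) sum≡0) (ℤ.*-zeroʳ a)) ,
    dot-ext λ g → begin
      dot g (k • (a • w))                          ≡⟨ dot-• g k (a • w) ⟩
      k * dot g (a • w)                            ≡⟨ cong (k *_) (dot-• g a w) ⟩
      k * (a * dot g w)                            ≡⟨ law k a (dot g w) ⟩
      a * (k * dot g w)                            ≡⟨ cong (a *_) (dot-• g k w) ⟨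
      a * dot g (k • w)                            ≡⟨ cong (λ z → a * dot g z) eq ⟩
      a * dot g (vsum (λ i → μ i • v P i))         ≡⟨ cong (a *_) (dot-lincomb g μ (v P)) ⟩
      a * sumℤ (λ i → μ i * dot g (v P i))         ≡⟨ sum-* a (λ i → μ i * dot g (v P i)) ⟨
      sumℤ (λ i → a * (μ i * dot g (v P i)))       ≡⟨ sum-cong (λ i → ℤ.*-assoc a (μ i) (dot g (v P i))) ⟨
      sumℤ (λ i → (a * μ i) * dot g (v P i))       ≡⟨ dot-lincomb g (λ i → a * μ i) (v P) ⟨
      dot g (vsum (λ i → (a * μ i) • v P i))       ∎
    where
    law : ∀ k a s → k * (a * s) ≡ a * (k * s)
    law = solve-∀

  InLin-divide : ∀ m {w} → m ≢ 0ℤ → InLin P F (m • w) → InLin P F w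
  InLin-divide m {w} m≢0 (k , k≢0 , μ , off , sum≡0 , eq) =
    k * m , *-≢0 k≢0 m≢0 , μ , off , sum≡0 ,
    trans (dot-ext λ g → begin
      dot g ((k * m) • w)  ≡⟨ dot-• g (k * m) w ⟩
      (k * m) * dot g w    ≡⟨ ℤ.*-assoc k m (dot g w) ⟩
      k * (m * dot g w)    ≡⟨ cong (k *_) (dot-• g m w) ⟨
      k * dot g (m • w)    ≡⟨ dot-• g k (m • w) ⟨
      dot g (k • (m • w))  ∎) eq

  InLin-difference : ∀ {i j} → i ∈ F → j ∈ F → InLin P F (v P i ⊖ v P j)
  InLin-difference {i} {j} i∈F j∈F =
    1ℤ , (λ ()) , ε ,
    (λ k k∉F → cong₂ _-_ (δ-off {i} {k} λ { refl → k∉F i∈F }) (δ-off {j} {k} λ { refl → k∉F j∈F })) ,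
    trans (sum-cong λ k → sym (ℤ.*-identityʳ (ε k))) (sum-ε (λ _ → 1ℤ)) ,
    dot-ext λ g → begin
      dot g (1ℤ • (v P i ⊖ v P j))        ≡⟨ dot-• g 1ℤ (v P i ⊖ v P j) ⟩
      1ℤ * dot g (v P i ⊖ v P j)          ≡⟨ ℤ.*-identityˡ _ ⟩
      dot g (v P i ⊖ v P j)               ≡⟨ dot-⊖ g (v P i) (v P j) ⟩
      dot g (v P i) - dot g (v P j)       ≡⟨ sum-ε (λ k → dot g (v P k)) ⟨
      sumℤ (λ k → ε k * dot g (v P k))    ≡⟨ dot-lincomb g ε (v P) ⟨
      dot g (vsum (λ k → ε k • v P k))    ∎
    where
    δ : Fin (n P) → Fin (n P) → ℤ
    δ i k = if does (k ≟ i) then 1ℤ else 0ℤ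
    δ-off : ∀ {i k} → k ≢ i → δ i k ≡ 0ℤ
    δ-off {i} {k} k≢i with k ≟ i
    ... | yes k≡i = contradiction k≡i k≢i
    ... | no  _   = refl
    δ-on : ∀ i → δ i i ≡ 1ℤ
    δ-on i with i ≟ i
    ... | yes _   = refl
    ... | no  i≢i = contradiction refl i≢i
    sum-δ : ∀ i (f : Fin (n P) → ℤ) → sumℤ (λ k → δ i k * f k) ≡ f i
    sum-δ i f = begin
      sumℤ (λ k → δ i k * f k) ≡⟨ sum-one i (λ k k≢i → trans (cong (_* f k) (δ-off k≢i)) (ℤ.*-zeroˡ (f k))) ⟩
      δ i i * f i              ≡⟨ cong (_* f i) (δ-on i) ⟩
      1ℤ * f i                 ≡⟨ ℤ.*-identityˡ (f i) ⟩
      f i                      ∎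
    ε : Fin (n P) → ℤ
    ε k = δ i k - δ j k
    law : ∀ s t r → (s - t) * r ≡ s * r + -1ℤ * (t * r)
    law = solve-∀
    sum-ε : ∀ f → sumℤ (λ k → ε k * f k) ≡ f i - f j
    sum-ε f = begin
      sumℤ (λ k → ε k * f k)
        ≡⟨ sum-cong (λ k → law (δ i k) (δ j k) (f k)) ⟩
      sumℤ (λ k → δ i k * f k + -1ℤ * (δ j k * f k))
        ≡⟨ sum-+ (λ k → δ i k * f k) (λ k → -1ℤ * (δ j k * f k)) ⟩
      sumℤ (λ k → δ i k * f k) + sumℤ (λ k → -1ℤ * (δ j k * f k))
        ≡⟨ cong (sumℤ (λ k → δ i k * f k) +_) (sum-* -1ℤ (λ k → δ j k * f k)) ⟩
      sumℤ (λ k → δ i k * f k) + -1ℤ * sumℤ (λ k → δ j k * f k)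
        ≡⟨ cong₂ (λ s t → s + -1ℤ * t) (sum-δ i f) (sum-δ j f) ⟩
      f i + -1ℤ * f j
        ≡⟨ cong (f i +_) (ℤ.-1*i≡-i (f j)) ⟩
      f i - f j ∎

-- Vanishing rows of a family of matrices related by pivoting

flip : ∀ {d} → Vec Bool d → Fin d → Vec Bool d
flip x i = updateAt x i not

injective⇒surjective : ∀ {n} {f : Fin n → Fin n} → Injective _≡_ _≡_ f → ∀ y → ∃[ x ] f x ≡ y
injective⇒surjective {suc n} {f} f-inj y = decidable-stable (any? λ x → f x ≟ y) λ y∉f →
  ℕ.1+n≰n (injective⇒≤ {f = λ x → punchOut {i = y} (λ y≡fx → y∉f (x , sym y≡fx))}
    (λ eq → f-inj (punchOut-injective {i = y} _ _ eq)))

module _ {d} (a : Vec Bool d → Fin d → Fin d → ℤ)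
  (diagonal : ∀ x i → a x i i ≡ -1ℤ)
  (pivot : ∀ x {i j k} → k ≢ i → j ≢ i → a (flip x i) k j ≡ a x k j + a x i j * a x k i)
  where

  a*a≡0 : ∀ x {i k} → k ≢ i → a x i k * a x k i ≡ 0ℤ
  a*a≡0 x {i} {k} k≢i = begin
    a x i k * a x k i                   ≡⟨ law (a x i k * a x k i) ⟩
    1ℤ + (-1ℤ + a x i k * a x k i)      ≡⟨ cong (λ z → 1ℤ + (z + a x i k * a x k i)) (diagonal x k) ⟨
    1ℤ + (a x k k + a x i k * a x k i)  ≡⟨ cong (1ℤ +_) (pivot x k≢i k≢i) ⟨
    1ℤ + a (flip x i) k k               ≡⟨ cong (1ℤ +_) (diagonal (flip x i) k) ⟩
    0ℤ                                  ∎
    where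
    law : ∀ s → s ≡ 1ℤ + (-1ℤ + s)
    law = solve-∀

  IsZeroRow : ∀ {n} → (Fin n → Fin d) → Vec Bool d → Fin n → Set
  IsZeroRow e x i = ∀ j → j ≢ i → a x (e i) (e j) ≡ 0ℤ

  zeroRow? : ∀ {n} (e : Fin n → Fin d) x → Dec (∃ (IsZeroRow e x))
  zeroRow? e x = any? λ i → all? λ j → ¬? (j ≟ i) →-dec (a x (e i) (e j) ℤ.≟ 0ℤ)

  zeroRow : ∀ {n} (e : Fin (suc n) → Fin d) → Injective _≡_ _≡_ e → ∀ x → ∃ (IsZeroRow e x)
  zeroRow {zero} e e-inj x = zero , λ { zero 0≢0 → contradiction refl 0≢0 }
  zeroRow {suc n} e e-inj x = decidable-stable (zeroRow? e x) λ none →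
    impossible λ i zero-i → none (i , zero-i)
    where
    e-≢ : ∀ {i j} → i ≢ j → e i ≢ e j
    e-≢ i≢j = i≢j ∘ e-inj

    delete : ∀ t y → ∃[ k ] (k ≢ t × ∀ j → j ≢ t → j ≢ k → a y (e k) (e j) ≡ 0ℤ)
    delete t y with zeroRow (e ∘ punchIn t) (λ {i} {j} eq → punchIn-injective t i j (e-inj eq)) y
    ... | k , zero-k = punchIn t k , punchInᵢ≢i t k , λ j j≢t j≢k →
      let t≢j = j≢t ∘ sym
          j≡  = punchIn-punchOut t≢j
      in subst (λ l → a y (e (punchIn t k)) (e l) ≡ 0ℤ) j≡
           (zero-k (punchOut t≢j) λ eq → j≢k (trans (sym j≡) (cong (punchIn t) eq)))

    -- If no row vanishes off the diagonal, the row of the submatrix without t which does has its only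
    -- nonzero off-diagonal entry in column t.  So t ↦ f t is injective, hence every row has exactly one
    -- such entry; but pivoting at p = f t exhibits a row r with two of them, in columns p and t.
    impossible : ¬ (∀ i → ¬ IsZeroRow e x i)
    impossible none = a-rt≢0 (f-row p t t≢p (t≢r ∘ (λ eq → trans eq (sym r≡fp))))
      where
      f : Fin (suc (suc n)) → Fin (suc (suc n))
      f t = proj₁ (delete t x)
      f≢ : ∀ t → f t ≢ t
      f≢ t = proj₁ (proj₂ (delete t x))
      f-row : ∀ t j → j ≢ t → j ≢ f t → a x (e (f t)) (e j) ≡ 0ℤ
      f-row t = proj₂ (proj₂ (delete t x))
      f-nonzero : ∀ t → a x (e (f t)) (e t) ≢ 0ℤ
      f-nonzero t ft≡0 = none (f t) row
        where
        row : IsZeroRow e x (f t)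
        row j j≢ft with j ≟ t
        ... | yes refl = ft≡0
        ... | no  j≢t  = f-row t j j≢t j≢ft
      f-inj : Injective _≡_ _≡_ f
      f-inj {t} {s} ft≡fs with t ≟ s
      ... | yes t≡s = t≡s
      ... | no  t≢s = contradiction (f-row s t t≢s (λ t≡fs → f≢ t (trans ft≡fs (sym t≡fs))))
        (subst (λ k → a x (e k) (e t) ≢ 0ℤ) ft≡fs (f-nonzero t))

      t p r : Fin (suc (suc n))
      t = zero
      p = f t
      r = proj₁ (delete p (flip x (e p)))
      r≢p : r ≢ p
      r≢p = proj₁ (proj₂ (delete p (flip x (e p))))
      t≢p : t ≢ p
      t≢p = f≢ t ∘ sym
      r-row : ∀ j → j ≢ p → j ≢ r → a x (e r) (e j) + a x (e p) (e j) * a x (e r) (e p) ≡ 0ℤ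
      r-row j j≢p j≢r = trans (sym (pivot x (e-≢ r≢p) (e-≢ j≢p)))
        (proj₂ (proj₂ (delete p (flip x (e p)))) j j≢p j≢r)
      a-rp≢0 : a x (e r) (e p) ≢ 0ℤ
      a-rp≢0 rp≡0 = none r row
        where
        row : IsZeroRow e x r
        row j j≢r with j ≟ p
        ... | yes refl = rp≡0
        ... | no  j≢p  = begin
          a x (e r) (e j)                                      ≡⟨ law (a x (e r) (e j)) (a x (e p) (e j)) ⟩
          a x (e r) (e j) + a x (e p) (e j) * 0ℤ               ≡⟨ cong (λ z → a x (e r) (e j) + a x (e p) (e j) * z) rp≡0 ⟨
          a x (e r) (e j) + a x (e p) (e j) * a x (e r) (e p)  ≡⟨ r-row j j≢p j≢r ⟩
          0ℤ                                                   ∎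
          where
          law : ∀ s q → s ≡ s + q * 0ℤ
          law = solve-∀
      t≢r : t ≢ r
      t≢r t≡r = a-rp≢0 (*-≡0 (subst (λ k → a x (e p) (e k) ≢ 0ℤ) t≡r (f-nonzero t))
        (a*a≡0 x (e-≢ r≢p)))
      r≡fp : r ≡ f p
      r≡fp with injective⇒surjective f-inj r
      ... | s , fs≡r with p ≟ s
      ...   | yes refl = sym fs≡r
      ...   | no  p≢s  = contradiction
        (subst (λ k → a x (e k) (e p) ≡ 0ℤ) fs≡r
          (f-row s p p≢s (λ p≡fs → r≢p (trans (sym fs≡r) (sym p≡fs)))))
        a-rp≢0
      a-rt≢0 : a x (e (f p)) (e t) ≢ 0ℤ
      a-rt≢0 fpt≡0 = a-rp≢0 (*-≡0 (f-nonzero t) (begin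
        a x (e p) (e t) * a x (e r) (e p)
          ≡⟨ ℤ.+-identityˡ _ ⟨
        0ℤ + a x (e p) (e t) * a x (e r) (e p)
          ≡⟨ cong (_+ a x (e p) (e t) * a x (e r) (e p)) rt≡0 ⟨
        a x (e r) (e t) + a x (e p) (e t) * a x (e r) (e p)
          ≡⟨ r-row t t≢p t≢r ⟩
        0ℤ ∎))
        where
        rt≡0 : a x (e r) (e t) ≡ 0ℤ
        rt≡0 = subst (λ k → a x (e k) (e t) ≡ 0ℤ) (sym r≡fp) fpt≡0

-- Faces of the standard cube

bit sgn : Bool → ℤ
bit b = if b then 1ℤ else 0ℤ
sgn b = if b then 1ℤ else -1ℤ

corner : ∀ {d} → Vec Bool d → Pt d
corner = map bit

lookup-ext : ∀ {d} {x y : Vec Bool d} → (∀ j → lookup x j ≡ lookup y j) → x ≡ y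
lookup-ext {x = x} {y} eq =
  trans (sym (tabulate∘lookup x)) (trans (tabulate-cong eq) (tabulate∘lookup y))

corner-injective : ∀ {d} {x y : Vec Bool d} → corner x ≡ corner y → x ≡ y
corner-injective {x = []} {[]} _ = refl
corner-injective {x = true  ∷ x} {true  ∷ y} eq = cong (true ∷_) (corner-injective (cong tail eq))
corner-injective {x = false ∷ x} {false ∷ y} eq = cong (false ∷_) (corner-injective (cong tail eq))

corner∈cubeList : ∀ {d} (x : Vec Bool d) → corner x ∈ₗ cubeList d
corner∈cubeList [] = here refl
corner∈cubeList (false ∷ x) = ∈-++⁺ˡ (∈-map⁺ (0ℤ ∷_) (corner∈cubeList x))
corner∈cubeList {suc d} (true ∷ x) =
  ∈-++⁺ʳ (L.map (0ℤ ∷_) (cubeList d)) (∈-map⁺ (1ℤ ∷_) (corner∈cubeList x))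

cubeList⇒corner : ∀ d {w : Pt d} → w ∈ₗ cubeList d → ∃[ x ] w ≡ corner x
cubeList⇒corner zero (here refl) = [] , refl
cubeList⇒corner (suc d) w∈ with ∈-++⁻ (L.map (0ℤ ∷_) (cubeList d)) w∈
... | inj₁ w∈₀ with ∈-map⁻ (0ℤ ∷_) w∈₀
...   | w′ , w′∈ , refl with cubeList⇒corner d w′∈
...     | x , refl = false ∷ x , refl
cubeList⇒corner (suc d) w∈ | inj₂ w∈₁ with ∈-map⁻ (1ℤ ∷_) w∈₁
...   | w′ , w′∈ , refl with cubeList⇒corner d w′∈
...     | x , refl = true ∷ x , refl

encode : ∀ {d} → Vec Bool d → Fin (n (Cube d))
encode x = index (corner∈cubeList x)

v-encode : ∀ {d} (x : Vec Bool d) → v (Cube d) (encode x) ≡ corner x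
v-encode x = sym (lookup-index (corner∈cubeList x))

decode : ∀ {d} → Fin (n (Cube d)) → Vec Bool d
decode {d} p = proj₁ (cubeList⇒corner d (∈-lookup p))

v-decode : ∀ {d} p → v (Cube d) p ≡ corner (decode p)
v-decode {d} p = proj₂ (cubeList⇒corner d (∈-lookup p))

decode-encode : ∀ {d} (x : Vec Bool d) → decode (encode x) ≡ x
decode-encode x = corner-injective (trans (sym (v-decode (encode x))) (v-encode x))

Agree : ∀ {d} → (Fin d → Set) → Vec Bool d → Vec Bool d → Set
Agree A x y = ∀ j → A j → lookup y j ≡ lookup x j

agree? : ∀ {d} {A : Fin d → Set} → Decidable A → ∀ x y → Dec (Agree A x y)
agree? A? x y = all? λ j → A? j →-dec (lookup y j Bool.≟ lookup x j)

weight : ∀ {A : Set} → Dec A → Bool → ℤ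
weight a? b = if does a? then sgn b else 0ℤ

weight-≤ : ∀ {A : Set} (a? : Dec A) b c → weight a? b * bit c ≤ weight a? b * bit b
weight-≤ (no  _) b     c     = ℤ.≤-reflexive (trans (ℤ.*-zeroˡ (bit c)) (sym (ℤ.*-zeroˡ (bit b))))
weight-≤ (yes _) true  true  = +≤+ ℕ.≤-refl
weight-≤ (yes _) true  false = +≤+ z≤n
weight-≤ (yes _) false true  = -≤+
weight-≤ (yes _) false false = +≤+ z≤n

weight-max : ∀ {A : Set} (a? : Dec A) b c → A → weight a? b * bit b ≤ weight a? b * bit c → c ≡ b
weight-max (no ¬a) b     c     a _ = contradiction a ¬a
weight-max (yes _) true  true  _ _ = refl
weight-max (yes _) true  false _ (+≤+ ())
weight-max (yes _) false true  _ ()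
weight-max (yes _) false false _ _ = refl

weight-agree : ∀ {A : Set} (a? : Dec A) b c → (A → c ≡ b) → weight a? b * bit b ≤ weight a? b * bit c
weight-agree (no  _) b c _ = weight-≤ (no λ z → z) c b
weight-agree (yes a) b c c≡b = ℤ.≤-reflexive (cong (λ z → weight (yes a) b * bit z) (sym (c≡b a)))

gauge : ∀ {d} {A : Fin d → Set} → Decidable A → Vec Bool d → Pt d
gauge A? []      = []
gauge A? (b ∷ x) = weight (A? zero) b ∷ gauge (A? ∘ suc) x

gauge-≤ : ∀ {d} {A : Fin d → Set} (A? : Decidable A) x y →
  dot (gauge A? x) (corner y) ≤ dot (gauge A? x) (corner x)
gauge-≤ A? []      []      = ℤ.≤-refl
gauge-≤ A? (b ∷ x) (c ∷ y) = ℤ.+-mono-≤ (weight-≤ (A? zero) b c) (gauge-≤ (A? ∘ suc) x y)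

gauge-agree : ∀ {d} {A : Fin d → Set} (A? : Decidable A) x y → Agree A x y →
  dot (gauge A? x) (corner x) ≤ dot (gauge A? x) (corner y)
gauge-agree A? []      []      _  = ℤ.≤-refl
gauge-agree A? (b ∷ x) (c ∷ y) ag =
  ℤ.+-mono-≤ (weight-agree (A? zero) b c (ag zero)) (gauge-agree (A? ∘ suc) x y (ag ∘ suc))

+-cancel-≤ˡ : ∀ s₁ s₂ t₁ t₂ → t₁ + t₂ ≤ s₁ + s₂ → s₂ ≤ t₂ → t₁ ≤ s₁
+-cancel-≤ˡ s₁ s₂ t₁ t₂ t≤s s₂≤t₂ =
  subst₂ _≤_ (law t₁ t₂) (law s₁ t₂)
    (ℤ.+-monoˡ-≤ (- t₂) (ℤ.≤-trans t≤s (ℤ.+-monoʳ-≤ s₁ s₂≤t₂)))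
  where
  law : ∀ s t → (s + t) - t ≡ s
  law = solve-∀

+-cancel-≤ʳ : ∀ s₁ s₂ t₁ t₂ → t₁ + t₂ ≤ s₁ + s₂ → s₁ ≤ t₁ → t₂ ≤ s₂
+-cancel-≤ʳ s₁ s₂ t₁ t₂ t≤s = +-cancel-≤ˡ s₂ s₁ t₂ t₁
  (subst₂ _≤_ (ℤ.+-comm t₁ t₂) (ℤ.+-comm s₁ s₂) t≤s)

gauge-max : ∀ {d} {A : Fin d → Set} (A? : Decidable A) x y →
  dot (gauge A? x) (corner x) ≤ dot (gauge A? x) (corner y) → Agree A x y
gauge-max A? (b ∷ x) (c ∷ y) x≤y zero a = weight-max (A? zero) b c a
  (+-cancel-≤ˡ (weight (A? zero) b * bit c) (dot (gauge (A? ∘ suc) x) (corner y))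
               (weight (A? zero) b * bit b) (dot (gauge (A? ∘ suc) x) (corner x))
    x≤y (gauge-≤ (A? ∘ suc) x y))
gauge-max A? (b ∷ x) (c ∷ y) x≤y (suc j) = gauge-max (A? ∘ suc) x y
  (+-cancel-≤ʳ (weight (A? zero) b * bit c) (dot (gauge (A? ∘ suc) x) (corner y))
               (weight (A? zero) b * bit b) (dot (gauge (A? ∘ suc) x) (corner x))
    x≤y (weight-≤ (A? zero) b c)) j

cubeFaceSet : ∀ {d} {A : Fin d → Set} → Decidable A → Vec Bool d → Subset (n (Cube d))
cubeFaceSet A? x = tabulate λ p → does (agree? A? x (decode p))

∈-cubeFaceSet : ∀ {d} {A : Fin d → Set} (A? : Decidable A) x p →
  p ∈ cubeFaceSet A? x ⇔ Agree A x (decode p)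
∈-cubeFaceSet A? x p = mk⇔
  (λ p∈ → does-true (agree? A? x (decode p)) (trans (sym (lookup∘tabulate _ p)) ([]=⇒lookup p∈)))
  (λ ag → lookup⇒[]= p _ (trans (lookup∘tabulate _ p) (dec-true (agree? A? x (decode p)) ag)))
  where
  does-true : ∀ {B : Set} (b? : Dec B) → does b? ≡ true → B
  does-true (yes b) _ = b

cubeFace : ∀ {d} {A : Fin d → Set} → Decidable A → Vec Bool d → Face (Cube d)
cubeFace {d} A? x = cubeFaceSet A? x , gauge A? x , λ p → mk⇔
  (λ p∈ q → subst₂ (λ s t → dot (gauge A? x) s ≤ dot (gauge A? x) t)
    (sym (v-decode q)) (sym (v-decode p))
    (ℤ.≤-trans (gauge-≤ A? x (decode q)) (gauge-agree A? x (decode p) (to (∈-cubeFaceSet A? x p) p∈))))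
  (λ max → from (∈-cubeFaceSet A? x p) (gauge-max A? x (decode p)
    (subst₂ (λ s t → dot (gauge A? x) s ≤ dot (gauge A? x) t)
      (v-encode x) (v-decode p) (max (encode x)))))
  where open Equivalence

∈-cubeFace : ∀ {d} {A : Fin d → Set} (A? : Decidable A) x y →
  encode y ∈ proj₁ (cubeFace A? x) ⇔ Agree A x y
∈-cubeFace A? x y = subst (λ z → encode y ∈ proj₁ (cubeFace A? x) ⇔ Agree _ x z)
  (decode-encode y) (∈-cubeFaceSet A? x (encode y))

dot-corner-flip : ∀ {d} (c : Pt d) x y i → lookup x i ≡ lookup y i →
  dot c (corner (flip x i)) - dot c (corner x) ≡ dot c (corner (flip y i)) - dot c (corner y)
dot-corner-flip (c₀ ∷ c) (b ∷ x) (b ∷ y) zero refl =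
  law (c₀ * bit (not b)) (c₀ * bit b) (dot c (corner x)) (dot c (corner y))
  where
  law : ∀ s t p q → (s + p) - (t + p) ≡ (s + q) - (t + q)
  law = solve-∀
dot-corner-flip (c₀ ∷ c) (b ∷ x) (b′ ∷ y) (suc i) eq =
  trans (law (c₀ * bit b) (dot c (corner (flip x i))) (dot c (corner x)))
    (trans (dot-corner-flip c x y i eq)
      (sym (law (c₀ * bit b′) (dot c (corner (flip y i))) (dot c (corner y)))))
  where
  law : ∀ s p q → (s + p) - (s + q) ≡ p - q
  law = solve-∀

lookup-flip : ∀ {d} (x : Vec Bool d) i → lookup (flip x i) i ≡ not (lookup x i)
lookup-flip x i = lookup∘updateAt i x

lookup-flip′ : ∀ {d} (x : Vec Bool d) {i j} → j ≢ i → lookup (flip x i) j ≡ lookup x j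
lookup-flip′ x j≢i = lookup∘updateAt′ _ _ j≢i x

flip-lookup : ∀ {d} (x : Vec Bool d) {i ε} → lookup x i ≢ ε → lookup (flip x i) i ≡ ε
flip-lookup x {i} {ε} x≢ε = trans (lookup-flip x i) (sym (Bool.¬-not (x≢ε ∘ sym)))

flip-≢ : ∀ {d} (x : Vec Bool d) i → x ≢ flip x i
flip-≢ x i eq = Bool.not-¬ {lookup x i} refl (trans (cong (λ z → lookup z i) eq) (lookup-flip x i))

flip-injective : ∀ {d} (x : Vec Bool d) {i j} → flip x i ≡ flip x j → i ≡ j
flip-injective x {i} {j} eq with i ≟ j
... | yes i≡j = i≡j
... | no  i≢j = contradiction
  (trans (sym (lookup-flip′ x i≢j)) (trans (cong (λ z → lookup z i) (sym eq)) (lookup-flip x i)))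
  (Bool.not-¬ {lookup x i} refl)

face-resp : ∀ {d} (P : PointConfig d) (F : Face P) {p q} → v P p ≡ v P q → p ∈ proj₁ F → q ∈ proj₁ F
face-resp P (F , c , F⇔) {p} {q} eq p∈ = from (F⇔ q) λ j →
  subst (λ w → dot c (v P j) ≤ dot c w) eq (to (F⇔ p) p∈ j)
  where open Equivalence

-- The functional exposing G takes one value on y and on its mirror image flip y i in the
-- facet; so flipping coordinate i never changes the value of the functional.
cube-facet-maximal : ∀ {d} i (x : Vec Bool d) (G : Face (Cube d)) →
  (∀ y → lookup y i ≡ lookup x i → encode y ∈ proj₁ G) →
  ∀ y → lookup y i ≢ lookup x i → encode y ∈ proj₁ G → ∀ z → encode z ∈ proj₁ G
cube-facet-maximal {d} i x (G , c , G⇔) facet⊆G y y≢x y∈G z with lookup z i Bool.≟ lookup x i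
... | yes z≡x = facet⊆G z z≡x
... | no  z≢x = from (G⇔ (encode z)) λ j →
    ℤ.≤-trans (to (G⇔ _) (facet⊆G (flip z i) (flip-lookup z z≢x)) j) z-max
  where
  open Equivalence
  C = λ w → dot c (corner w)
  y-max : C (flip y i) ≤ C y
  y-max = subst₂ (λ s t → dot c s ≤ dot c t) (v-encode (flip y i)) (v-encode y)
    (to (G⇔ (encode y)) y∈G (encode (flip y i)))
  z≡y : lookup z i ≡ lookup y i
  z≡y = trans (Bool.¬-not z≢x) (sym (Bool.¬-not y≢x))
  z-max : dot c (v (Cube d) (encode (flip z i))) ≤ dot c (v (Cube d) (encode z))
  z-max = subst₂ (λ s t → dot c s ≤ dot c t) (sym (v-encode (flip z i))) (sym (v-encode z))
    (ℤ.i-j≤0⇒i≤j (subst (_≤ 0ℤ) (sym (dot-corner-flip c z y i z≡y)) (ℤ.i≤j⇒i-j≤0 y-max)))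

-- Labelling the vertices of a combinatorial cube

argmax : ∀ {n} (f : Fin (suc n) → ℤ) → ∃[ i ] (∀ j → f j ≤ f i)
argmax {zero} f = zero , λ { zero → ℤ.≤-refl }
argmax {suc n} f with argmax (f ∘ suc)
... | i , max with ℤ.≤-total (f zero) (f (suc i))
...   | inj₁ 0≤i = suc i , λ { zero → 0≤i ; (suc j) → max j }
...   | inj₂ i≤0 = zero , λ { zero → ℤ.≤-refl ; (suc j) → ℤ.≤-trans (max j) i≤0 }

face-nonempty : ∀ {d} (P : PointConfig d) → Fin (n P) → (F : Face P) → ∃[ i ] i ∈ proj₁ F
face-nonempty (conf (suc _) v) _ (F , c , F⇔) with argmax (λ i → dot c (v i))
... | i , max = i , Equivalence.from (F⇔ i) max

singleton⊆ : ∀ {m} {i : Fin m} {F : Subset m} → i ∈ F → ⁅ i ⁆ ⊆ F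
singleton⊆ {i = i} i∈F j∈ with x∈⁅y⁆⇒x≡y i j∈
... | refl = i∈F

record Labelling {d} (P : PointConfig d) : Set₁ where
  field
    pt       : Vec Bool d → Fin (n P)
    pt-surj  : ∀ i → ∃[ x ] pt x ≡ i
    face     : ∀ {A : Fin d → Set} → Decidable A → Vec Bool d → Face P
    ∈-face   : ∀ {A : Fin d → Set} (A? : Decidable A) x y → pt y ∈ proj₁ (face A? x) ⇔ Agree A x y
    facet-maximal : ∀ i x (G : Face P) → proj₁ (face (_≟ i) x) ⊆ proj₁ G →
      ∀ y → lookup y i ≢ lookup x i → pt y ∈ proj₁ G → ∀ z → pt z ∈ proj₁ G

module _ {d} (P : PointConfig (suc d)) (vertices : AllVertices P) (iso : IsCombinatorialCube P) where
  open FacePosetIso iso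
  private
    Q = Cube (suc d)
    module ⇔ = Equivalence

  vertex : Vec Bool (suc d) → Face Q
  vertex = cubeFace {A = λ _ → 𝟙} (λ _ → yes tt)

  ∈-vertex : ∀ x p → p ∈ proj₁ (vertex x) → decode p ≡ x
  ∈-vertex x p p∈ = lookup-ext λ j → ⇔.to (∈-cubeFaceSet {A = λ _ → 𝟙} (λ _ → yes tt) x p) p∈ j tt

  inhabited : Fin (n P)
  inhabited = case (n P) (λ i → i) λ empty →
    contradiction
      (trans (sym (decode-encode xs))
        (∈-vertex ys (encode xs)
          (to∘from⊆ ys (⇔.to (mono (from (vertex xs)) (from (vertex ys))) (λ {i} _ → ⊥-elim (empty i))
            (⊆to∘from xs (⇔.from (∈-cubeFace (λ _ → yes tt) xs xs) (λ _ _ → refl)))))))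
      λ ()
    where
    case : ∀ m {C : Set} → (Fin m → C) → ((Fin m → ⊥) → C) → C
    case zero    f g = g λ ()
    case (suc m) f g = f zero
    xs ys : Vec Bool (suc d)
    xs = replicate _ true
    ys = replicate _ false
    ⊆to∘from : ∀ x → proj₁ (vertex x) ⊆ proj₁ (to (from (vertex x)))
    ⊆to∘from x {p} = subst (p ∈_) (sym (to∘from (vertex x)))
    to∘from⊆ : ∀ x → proj₁ (to (from (vertex x))) ⊆ proj₁ (vertex x)
    to∘from⊆ x {p} = subst (p ∈_) (to∘from (vertex x))

  point : Fin (n P) → Face P
  point i = ⁅ i ⁆ , vertices i

  labelled : ∀ x → ∃[ i ] (∀ (F : Face P) → i ∈ proj₁ F ⇔ encode x ∈ proj₁ (to F))
  labelled x = i , λ F → mk⇔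
    (λ i∈F → ⇔.to (mono (point i) F) (singleton⊆ i∈F) x∈)
    (λ x∈F → ⇔.from (mono (point i) F)
      (λ {p} p∈ → face-resp Q (to F)
        (trans (v-encode x) (trans (cong corner (sym (∈-vertex x p (point⊆vertex p∈)))) (sym (v-decode p)))) x∈F)
      (x∈⁅x⁆ i))
    where
    i : Fin (n P)
    i = proj₁ (face-nonempty P inhabited (from (vertex x)))
    point⊆vertex : proj₁ (to (point i)) ⊆ proj₁ (vertex x)
    point⊆vertex {p} p∈ = subst (p ∈_) (to∘from (vertex x))
      (⇔.to (mono (point i) (from (vertex x)))
        (singleton⊆ (proj₂ (face-nonempty P inhabited (from (vertex x))))) p∈)
    x∈ : encode x ∈ proj₁ (to (point i))
    x∈ = let p , p∈ = face-nonempty Q (encode x) (to (point i)) in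
      face-resp Q (to (point i)) (trans (v-decode p) (trans (cong corner (∈-vertex x p (point⊆vertex p∈))) (sym (v-encode x)))) p∈

  labelling : Labelling P
  labelling = record
    { pt = pt
    ; pt-surj = λ i → let p , p∈ = face-nonempty Q (encode {suc d} (replicate _ true)) (to (point i)) in
        decode p , x∈⁅y⁆⇒x≡y i (⇔.from (∈to (decode p) (point i))
          (face-resp Q (to (point i)) (trans (v-decode p) (sym (v-encode (decode p)))) p∈))
    ; face = λ A? x → from (cubeFace A? x)
    ; ∈-face = ∈from
    ; facet-maximal = λ i x G F⊆G y y≢x y∈G z → ⇔.from (∈to z G)
        (cube-facet-maximal i x (to G)
          (λ w w≡x → ⇔.to (∈to w G) (F⊆G (⇔.from (∈from (_≟ i) x w) λ { _ refl → w≡x })))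
          y y≢x (⇔.to (∈to y G) y∈G) z)
    }
    where
    pt : Vec Bool (suc d) → Fin (n P)
    pt x = proj₁ (labelled x)
    ∈to : ∀ x F → pt x ∈ proj₁ F ⇔ encode x ∈ proj₁ (to F)
    ∈to x = proj₂ (labelled x)
    ∈from : ∀ {A : Fin (suc d) → Set} (A? : Decidable A) x y → pt y ∈ proj₁ (from (cubeFace A? x)) ⇔ Agree A x y
    ∈from A? x y = mk⇔
      (λ y∈ → ⇔.to (∈-cubeFace A? x y) (subst (encode y ∈_) (to∘from (cubeFace A? x))
        (⇔.to (∈to y (from (cubeFace A? x))) y∈)))
      (λ ag → ⇔.from (∈to y (from (cubeFace A? x)))
        (subst (encode y ∈_) (sym (to∘from (cubeFace A? x))) (⇔.from (∈-cubeFace A? x y) ag)))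

-- Edges and facet normals of a smooth combinatorial cube

∣⁅i⁆∪⁅j⁆∣≡2 : ∀ {m} {i j : Fin m} → i ≢ j → ∣ ⁅ i ⁆ ∪ ⁅ j ⁆ ∣ ≡ 2
∣⁅i⁆∪⁅j⁆∣≡2 {i = zero}  {zero}  i≢j = contradiction refl i≢j
∣⁅i⁆∪⁅j⁆∣≡2 {i = zero}  {suc j} i≢j =
  cong suc (trans (cong ∣_∣ (∪-identityˡ ⁅ j ⁆)) (∣⁅x⁆∣≡1 j))
∣⁅i⁆∪⁅j⁆∣≡2 {i = suc i} {zero}  i≢j =
  cong suc (trans (cong ∣_∣ (∪-identityʳ ⁅ i ⁆)) (∣⁅x⁆∣≡1 i))
∣⁅i⁆∪⁅j⁆∣≡2 {i = suc i} {suc j} i≢j = ∣⁅i⁆∪⁅j⁆∣≡2 (i≢j ∘ cong suc)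

i<j⇒i-j<0 : ∀ {i j} → i < j → i - j < 0ℤ
i<j⇒i-j<0 {i} {j} i<j = subst (i - j <_) (ℤ.+-inverseʳ j) (ℤ.+-monoˡ-< (- j) i<j)

∣-antisym-neg : ∀ {s t} → s < 0ℤ → t < 0ℤ → s ∣ t → t ∣ s → s ≡ t
∣-antisym-neg { -[1+ _ ]} { -[1+ _ ]} _ _ s∣t t∣s =
  cong (λ { zero → 0ℤ ; (suc m) → -[1+ m ] }) (ℕ.∣-antisym (∣⇒∣ᵤ s∣t) (∣⇒∣ᵤ t∣s))
∣-antisym-neg {pos _} (+<+ ()) _ _ _
∣-antisym-neg { -[1+ _ ]} {pos _} _ (+<+ ()) _ _

neg-unit : ∀ {s t} → s < 0ℤ → s * t ≡ 1ℤ → s ≡ -1ℤ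
neg-unit {s} {t} s<0 st≡1 = ∣-antisym-neg s<0 -<+
  (divides (- t) (trans (cong -_ (sym st≡1)) (law₁ s t))) (divides (- s) (law₂ s))
  where
  law₁ : ∀ s t → - (s * t) ≡ - t * s
  law₁ = solve-∀
  law₂ : ∀ s → s ≡ - s * -1ℤ
  law₂ = solve-∀

primitive⇒multiple : ∀ {d} {w p : Pt d} → IsPrimitiveDir w p → ∃[ l ] w ≡ pos (suc l) • p
primitive⇒multiple ((suc l , _ , eq) , _) = l , eq

module Stars {d} (P : PointConfig d) (L : Labelling P) where
  open Labelling L
  private module ⇔ = Equivalence

  V : Vec Bool d → Pt d
  V x = v P (pt x)

  pt-injective : ∀ x y → pt x ≡ pt y → x ≡ y
  pt-injective x y eq = lookup-ext λ j →
    ⇔.to (∈-face all y x) (subst (_∈ proj₁ (face all y)) (sym eq) (⇔.from (∈-face all y y) λ _ _ → refl)) j tt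
    where
    all : Decidable (λ (_ : Fin d) → 𝟙)
    all _ = yes tt

  adjacent : ∀ x i → Adjacent P (pt x) (pt (flip x i))
  adjacent x i = subst (IsFace P) edge≡ (proj₂ (face ≢i? x)) , ∣⁅i⁆∪⁅j⁆∣≡2 (flip-≢ x i ∘ pt-injective x (flip x i))
    where
    ≢i? : Decidable (_≢ i)
    ≢i? j = ¬? (j ≟ i)
    agree⇒ : ∀ y → Agree (_≢ i) x y → pt y ∈ ⁅ pt x ⁆ ∪ ⁅ pt (flip x i) ⁆
    agree⇒ y ag with lookup y i Bool.≟ lookup x i
    ... | yes y≡x = x∈p∪q⁺ (inj₁ (subst (λ z → pt y ∈ ⁅ pt z ⁆) (lookup-ext y≗x) (x∈⁅x⁆ (pt y))))
      where
      y≗x : ∀ j → lookup y j ≡ lookup x j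
      y≗x j with j ≟ i
      ... | yes refl = y≡x
      ... | no  j≢i  = ag j j≢i
    ... | no  y≢x = x∈p∪q⁺ (inj₂ (subst (λ z → pt y ∈ ⁅ pt z ⁆) (lookup-ext y≗x) (x∈⁅x⁆ (pt y))))
      where
      y≗x : ∀ j → lookup y j ≡ lookup (flip x i) j
      y≗x j with j ≟ i
      ... | yes refl = trans (Bool.¬-not y≢x) (sym (lookup-flip x i))
      ... | no  j≢i  = trans (ag j j≢i) (sym (lookup-flip′ x j≢i))
    edge⊆ : proj₁ (face ≢i? x) ⊆ ⁅ pt x ⁆ ∪ ⁅ pt (flip x i) ⁆
    edge⊆ {p} p∈ with pt-surj p
    ... | y , refl = agree⇒ y (⇔.to (∈-face ≢i? x y) p∈)
    ⊆edge : ⁅ pt x ⁆ ∪ ⁅ pt (flip x i) ⁆ ⊆ proj₁ (face ≢i? x)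
    ⊆edge p∈ with x∈p∪q⁻ ⁅ pt x ⁆ _ p∈
    ... | inj₁ p∈₁ = singleton⊆ (⇔.from (∈-face ≢i? x x) λ _ _ → refl) p∈₁
    ... | inj₂ p∈₂ = singleton⊆ (⇔.from (∈-face ≢i? x (flip x i)) λ _ j≢i → lookup-flip′ x j≢i) p∈₂
    edge≡ : proj₁ (face ≢i? x) ≡ ⁅ pt x ⁆ ∪ ⁅ pt (flip x i) ⁆
    edge≡ = ⊆-antisym edge⊆ ⊆edge

  record Star (x : Vec Bool d) : Set₁ where
    field
      u      : Fin d → Pt d
      length : Fin d → ℕ
      edge   : ∀ i → V (flip x i) ⊖ V x ≡ pos (suc (length i)) • u i
      spanned : (R : Pt d → Set) → R 𝟘 → (∀ {a b} → R a → R b → R (a ⊕ b)) →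
        (∀ a i → R (a • u i)) → ∀ w → R w

  star : IsSmooth P → ∀ x → Star x
  star smooth x with smooth (pt x)
  ... | nb , u′ , _ , adj⇔ , prim , spans , _ = record
    { u = u′ ∘ κ
    ; length = proj₁ ∘ step
    ; edge = proj₂ ∘ step
    ; spanned = λ R R𝟘 R⊕ R• w → subst R (proj₂ (spans w))
        (vsum-closed R R𝟘 R⊕ (λ k → proj₁ (spans w) k • u′ k)
          λ k → let i , κi≡k = injective⇒surjective κ-inj k in
            subst (λ l → R (proj₁ (spans w) k • u′ l)) κi≡k (R• (proj₁ (spans w) k) i))
    }
    where
    κ : Fin d → Fin d
    κ i = proj₁ (⇔.to (adj⇔ (pt (flip x i))) (adjacent x i))
    nb-κ : ∀ i → nb (κ i) ≡ pt (flip x i)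
    nb-κ i = proj₂ (⇔.to (adj⇔ (pt (flip x i))) (adjacent x i))
    κ-inj : Injective _≡_ _≡_ κ
    κ-inj {i} {j} eq = flip-injective x (pt-injective (flip x i) (flip x j)
      (trans (sym (nb-κ i)) (trans (cong nb eq) (nb-κ j))))
    step : ∀ i → ∃[ l ] V (flip x i) ⊖ V x ≡ pos (suc l) • u′ (κ i)
    step i = let l , eq = primitive⇒multiple (prim (κ i)) in
      l , trans (cong (λ p → v P p ⊖ V x) (sym (nb-κ i))) eq

module Facets {d} (P : PointConfig d) (L : Labelling P) (star : ∀ x → Stars.Star P L x) where
  open Labelling L
  open Stars P L using (V; module Star)
  private module ⇔ = Equivalence

  module _ (x : Vec Bool d) where
    open Star (star x) public using (u; spanned)

  module _ (x : Vec Bool d) (i : Fin d) where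
    open Star (star x)
    m : ℤ
    m = pos (suc (length i))
    m≢0 : m ≢ 0ℤ
    m≢0 ()

  edge : ∀ x i → V (flip x i) ⊖ V x ≡ m x i • u x i
  edge x = Star.edge (star x)

  dot-edge : ∀ g x i → dot g (V (flip x i)) - dot g (V x) ≡ m x i * dot g (u x i)
  dot-edge g x i = trans (sym (dot-⊖ g (V (flip x i)) (V x)))
    (trans (cong (dot g) (edge x i)) (dot-• g (m x i) (u x i)))

  facet : Fin d → Bool → Face P
  facet i ε = face (_≟ i) (replicate d ε)

  ∈-facet : ∀ i ε y → pt y ∈ proj₁ (facet i ε) ⇔ lookup y i ≡ ε
  ∈-facet i ε y = mk⇔
    (λ y∈ → trans (⇔.to (∈-face (_≟ i) (replicate d ε) y) y∈ i refl) (lookup-replicate i ε))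
    (λ y≡ε → ⇔.from (∈-face (_≟ i) (replicate d ε) y) λ { _ refl → trans y≡ε (sym (lookup-replicate i ε)) })

  x∉facet-not : ∀ i ε y → lookup y i ≡ not ε → pt y ∉ proj₁ (facet i ε)
  x∉facet-not i ε y y≡¬ε y∈ = Bool.not-¬ (⇔.to (∈-facet i ε y) y∈) y≡¬ε

  facet-isFacet : ∀ i ε → IsFacet P (proj₁ (facet i ε))
  facet-isFacet i ε = proj₂ (facet i ε) ,
    (λ F≡⊤ → x∉facet-not i ε (replicate d (not ε)) (lookup-replicate i (not ε)) (subst (_ ∈_) (sym F≡⊤) ∈⊤)) ,
    maximal
    where
    F : Subset (n P)
    F = proj₁ (facet i ε)
    maximal : ∀ G → IsFace P G → F ⊆ G → G ≡ F ⊎ G ≡ ⊤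
    maximal G G-face F⊆G with any? (λ p → (p ∈? G) ×-dec ¬? (p ∈? F))
    ... | no  G⊆F = inj₁ (⊆-antisym (λ {p} p∈G → decidable-stable (p ∈? F) λ p∉F → G⊆F (p , p∈G , p∉F)) F⊆G)
    ... | yes (p , p∈G , p∉F) with pt-surj p
    ...   | y , refl = inj₂ (⊆-antisym (λ _ → ∈⊤) ⊤⊆G)
      where
      ⊤⊆G : ⊤ ⊆ G
      ⊤⊆G {q} _ with pt-surj q
      ... | z , refl = facet-maximal i (replicate d ε) (G , G-face) F⊆G y
        (λ y≡ → p∉F (⇔.from (∈-facet i ε y) (trans y≡ (lookup-replicate i ε)))) p∈G z

  record Normal (i : Fin d) (ε : Bool) : Set where
    field
      h     : Pt d
      h-on  : ∀ x → lookup x i ≡ ε → dot h (u x i) ≡ 1ℤ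
      h-off : ∀ x {j} → lookup x i ≡ ε → j ≢ i → dot h (u x j) ≡ 0ℤ
      h-const : ∀ y z → lookup y i ≡ ε → lookup z i ≡ ε → dot h (V y) ≡ dot h (V z)

  -- Since u x is a lattice basis, an outer normal c of the facet maps ℤ^d onto (c · u x i) ℤ for each
  -- vertex x of the facet; hence c · u x i does not depend on x, and dividing by it normalises c.
  normal : ∀ i ε → Normal i ε
  normal i ε = record
    { h = h
    ; h-on = λ x x≡ε → ℤ.*-cancelˡ-≡ μ (dot h (u x i)) 1ℤ {{μ-nonZero}} (begin
        μ * dot h (u x i)  ≡⟨ c≡μh (u x i) ⟨
        dot c (u x i)      ≡⟨ ∣-antisym-neg (steep x x≡ε) (steep x₀ x₀≡ε) (generates x x≡ε (u x₀ i)) (generates x₀ x₀≡ε (u x i)) ⟩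
        μ                  ≡⟨ ℤ.*-identityʳ μ ⟨
        μ * 1ℤ             ∎)
    ; h-off = λ x {j} x≡ε j≢i → ℤ.*-cancelˡ-≡ μ (dot h (u x j)) 0ℤ {{μ-nonZero}}
        (trans (sym (c≡μh (u x j))) (trans (flat x x≡ε j≢i) (sym (ℤ.*-zeroʳ μ))))
    ; h-const = λ y z y≡ε z≡ε → ℤ.*-cancelˡ-≡ μ (dot h (V y)) (dot h (V z)) {{μ-nonZero}}
        (trans (sym (c≡μh (V y))) (trans (level y z y≡ε z≡ε) (c≡μh (V z))))
    }
    where
    c : Pt d
    c = proj₁ (proj₂ (facet i ε))
    maximal : ∀ y → pt y ∈ proj₁ (facet i ε) ⇔ (∀ j → dot c (v P j) ≤ dot c (V y))
    maximal y = proj₂ (proj₂ (facet i ε)) (pt y)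
    above : ∀ y z → lookup y i ≡ ε → dot c (V z) ≤ dot c (V y)
    above y z y≡ε = ⇔.to (maximal y) (⇔.from (∈-facet i ε y) y≡ε) (pt z)
    level : ∀ y z → lookup y i ≡ ε → lookup z i ≡ ε → dot c (V y) ≡ dot c (V z)
    level y z y≡ε z≡ε = ℤ.≤-antisym (above z y z≡ε) (above y z y≡ε)
    below : ∀ y z → lookup y i ≡ ε → lookup z i ≢ ε → dot c (V z) < dot c (V y)
    below y z y≡ε z≢ε = ℤ.≰⇒> λ y≤z → z≢ε (⇔.to (∈-facet i ε z) (⇔.from (maximal z) λ j →
      ℤ.≤-trans (⇔.to (maximal y) (⇔.from (∈-facet i ε y) y≡ε) j) y≤z))
    flat : ∀ x {j} → lookup x i ≡ ε → j ≢ i → dot c (u x j) ≡ 0ℤ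
    flat x {j} x≡ε j≢i = *-≡0 (m≢0 x j) (trans (sym (dot-edge c x j))
      (ℤ.i≡j⇒i-j≡0 (level (flip x j) x (trans (lookup-flip′ x (j≢i ∘ sym)) x≡ε) x≡ε)))
    steep : ∀ x → lookup x i ≡ ε → dot c (u x i) < 0ℤ
    steep x x≡ε = ℤ.*-cancelˡ-<-nonNeg (m x i) (subst₂ _<_ (dot-edge c x i) (sym (ℤ.*-zeroʳ (m x i)))
      (i<j⇒i-j<0 (below x (flip x i) x≡ε λ fx≡ε →
        Bool.not-¬ (trans fx≡ε (sym x≡ε)) (lookup-flip x i))))
    generates : ∀ x → lookup x i ≡ ε → ∀ w → dot c (u x i) ∣ dot c w
    generates x x≡ε = spanned x (λ w → dot c (u x i) ∣ dot c w)
      (subst (dot c (u x i) ∣_) (sym (dot-𝟘 c)) (divides 0ℤ (sym (ℤ.*-zeroˡ (dot c (u x i))))))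
      (λ {a} {b} a∣ b∣ → subst (dot c (u x i) ∣_) (sym (dot-⊕ c a b)) (∣m∣n⇒∣m+n a∣ b∣))
      (λ a j → subst (dot c (u x i) ∣_) (sym (dot-• c a (u x j))) (∣n⇒∣m*n a (term j)))
      where
      term : ∀ j → dot c (u x i) ∣ dot c (u x j)
      term j with j ≟ i
      ... | yes refl = ∣-refl
      ... | no  j≢i  = divides 0ℤ (trans (flat x x≡ε j≢i) (sym (ℤ.*-zeroˡ (dot c (u x i)))))
    x₀ : Vec Bool d
    x₀ = replicate d ε
    x₀≡ε : lookup x₀ i ≡ ε
    x₀≡ε = lookup-replicate i ε
    μ : ℤ
    μ = dot c (u x₀ i)
    μ-nonZero : NonZero μ
    μ-nonZero = ≢-nonZero λ μ≡0 → ℤ.<-irrefl μ≡0 (steep x₀ x₀≡ε)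
    h : Pt d
    h = proj₁ (divide-functional c μ (generates x₀ x₀≡ε))
    c≡μh : ∀ w → dot c w ≡ μ * dot h w
    c≡μh = proj₂ (divide-functional c μ (generates x₀ x₀≡ε))

module Slopes {d} (P : PointConfig d) (L : Labelling P) (star : ∀ x → Stars.Star P L x)
  (normal : ∀ i ε → Facets.Normal P L star i ε) where
  open Labelling L
  open Stars P L using (V)
  open Facets P L star hiding (normal)
  private module ⇔ = Equivalence

  h : Fin d → Bool → Pt d
  h i ε = Normal.h (normal i ε)

  h-on : ∀ {i ε} x → lookup x i ≡ ε → dot (h i ε) (u x i) ≡ 1ℤ
  h-on {i} {ε} = Normal.h-on (normal i ε)

  h-off : ∀ {i ε} x {j} → lookup x i ≡ ε → j ≢ i → dot (h i ε) (u x j) ≡ 0ℤ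
  h-off {i} {ε} = Normal.h-off (normal i ε)

  h-const : ∀ {i ε} y z → lookup y i ≡ ε → lookup z i ≡ ε → dot (h i ε) (V y) ≡ dot (h i ε) (V z)
  h-const {i} {ε} = Normal.h-const (normal i ε)

  coord : Vec Bool d → Fin d → Pt d → ℤ
  coord x k = dot (h k (lookup x k))

  coord-other : ∀ x y {i j} → lookup x i ≡ lookup y i → j ≢ i → coord x i (u y j) ≡ 0ℤ
  coord-other x y x≡y = h-off y (sym x≡y)

  expand : ∀ x g w → dot g w ≡ sumℤ (λ k → coord x k w * dot g (u x k))
  expand x g = spanned x (λ w → dot g w ≡ sumℤ (λ k → coord x k w * dot g (u x k)))
    (trans (dot-𝟘 g) (sym (sum-zero λ k → trans (cong (_* dot g (u x k)) (dot-𝟘 (h k (lookup x k)))) (ℤ.*-zeroˡ (dot g (u x k))))))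
    (λ {a} {b} eqa eqb → begin
      dot g (a ⊕ b)      ≡⟨ dot-⊕ g a b ⟩
      dot g a + dot g b  ≡⟨ cong₂ _+_ eqa eqb ⟩
      sumℤ (λ k → coord x k a * dot g (u x k)) + sumℤ (λ k → coord x k b * dot g (u x k))
        ≡⟨ sum-+ (λ k → coord x k a * dot g (u x k)) (λ k → coord x k b * dot g (u x k)) ⟨
      sumℤ (λ k → coord x k a * dot g (u x k) + coord x k b * dot g (u x k))
        ≡⟨ sum-cong (λ k → trans (sym (ℤ.*-distribʳ-+ (dot g (u x k)) (coord x k a) (coord x k b)))
             (cong (_* dot g (u x k)) (sym (dot-⊕ (h k (lookup x k)) a b)))) ⟩
      sumℤ (λ k → coord x k (a ⊕ b) * dot g (u x k)) ∎)
    (λ a i → begin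
      dot g (a • u x i)  ≡⟨ dot-• g a (u x i) ⟩
      a * dot g (u x i)  ≡⟨ cong (_* dot g (u x i)) (trans (dot-• (h i (lookup x i)) a (u x i))
                              (trans (cong (a *_) (h-on x refl)) (ℤ.*-identityʳ a))) ⟨
      coord x i (a • u x i) * dot g (u x i)
        ≡⟨ sum-one i (λ k k≢i → trans (cong (_* dot g (u x k))
             (trans (dot-• (h k (lookup x k)) a (u x i))
               (trans (cong (a *_) (h-off x refl (k≢i ∘ sym))) (ℤ.*-zeroʳ a)))) (ℤ.*-zeroˡ (dot g (u x k)))) ⟨
      sumℤ (λ k → coord x k (a • u x i) * dot g (u x k)) ∎)

  slope : Vec Bool d → Fin d → Fin d → ℤ
  slope x i j = dot (h i (not (lookup x i))) (u x j)

  slope-diagonal : ∀ x i → slope x i i ≡ -1ℤ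
  slope-diagonal x i = neg-unit negative unit
    where
    y : Vec Bool d
    y = flip x i
    g : Pt d
    g = h i (not (lookup x i))
    g-on : dot g (u y i) ≡ 1ℤ
    g-on = h-on y (lookup-flip x i)
    flip-flip : flip y i ≡ x
    flip-flip = lookup-ext λ j → pointwise j
      where
      pointwise : ∀ j → lookup (flip y i) j ≡ lookup x j
      pointwise j with j ≟ i
      ... | yes refl = trans (lookup-flip y i) (trans (cong not (lookup-flip x i)) (Bool.not-involutive (lookup x i)))
      ... | no  j≢i  = trans (lookup-flip′ y j≢i) (lookup-flip′ x j≢i)
    opposite : m x i * slope x i i ≡ - m y i
    opposite = begin
      m x i * dot g (u x i)                ≡⟨ dot-edge g x i ⟨
      dot g (V y) - dot g (V x)            ≡⟨ law (dot g (V y)) (dot g (V x)) ⟩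
      - (dot g (V x) - dot g (V y))        ≡⟨ cong (λ z → - (dot g (V z) - dot g (V y))) flip-flip ⟨
      - (dot g (V (flip y i)) - dot g (V y)) ≡⟨ cong -_ (dot-edge g y i) ⟩
      - (m y i * dot g (u y i))            ≡⟨ cong (λ z → - (m y i * z)) g-on ⟩
      - (m y i * 1ℤ)                       ≡⟨ cong -_ (ℤ.*-identityʳ (m y i)) ⟩
      - m y i                              ∎
      where
      law : ∀ s t → s - t ≡ - (t - s)
      law = solve-∀
    negative : slope x i i < 0ℤ
    negative = ℤ.*-cancelˡ-<-nonNeg (m x i) (subst₂ _<_ (sym opposite) (sym (ℤ.*-zeroʳ (m x i))) -<+)
    unit : slope x i i * coord x i (u y i) ≡ 1ℤ
    unit = trans (ℤ.*-comm (slope x i i) _) (begin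
      coord x i (u y i) * dot g (u x i)
        ≡⟨ sum-one i (λ k k≢i → trans (cong (_* dot g (u x k))
             (coord-other x y (sym (lookup-flip′ x k≢i)) (k≢i ∘ sym))) (ℤ.*-zeroˡ (dot g (u x k)))) ⟨
      sumℤ (λ k → coord x k (u y i) * dot g (u x k)) ≡⟨ expand x g (u y i) ⟨
      dot g (u y i)                                  ≡⟨ g-on ⟩
      1ℤ                                             ∎)

  dot-u-flip : ∀ x {i j} → j ≢ i → ∀ g → dot g (u (flip x i) j) ≡ dot g (u x j) + slope x i j * dot g (u x i)
  dot-u-flip x {i} {j} j≢i g = trans (shear g) (cong (λ z → dot g (u x j) + z * dot g (u x i)) s≡slope)
    where
    w : Pt d
    w = u (flip x i) j
    s : ℤ
    s = coord x i w
    same : ∀ {k} → k ≢ i → lookup (flip x i) k ≡ lookup x k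
    same = lookup-flip′ x
    shear : ∀ g → dot g w ≡ dot g (u x j) + s * dot g (u x i)
    shear g = begin
      dot g w                                   ≡⟨ expand x g w ⟩
      sumℤ (λ k → coord x k w * dot g (u x k))
        ≡⟨ sum-two j≢i (λ k k≢j k≢i → trans (cong (_* dot g (u x k))
             (coord-other x (flip x i) (sym (same k≢i)) (k≢j ∘ sym))) (ℤ.*-zeroˡ (dot g (u x k)))) ⟩
      coord x j w * dot g (u x j) + s * dot g (u x i)
        ≡⟨ cong (λ z → z * dot g (u x j) + s * dot g (u x i)) (h-on (flip x i) (same j≢i)) ⟩
      1ℤ * dot g (u x j) + s * dot g (u x i)    ≡⟨ cong (_+ s * dot g (u x i)) (ℤ.*-identityˡ (dot g (u x j))) ⟩
      dot g (u x j) + s * dot g (u x i)         ∎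
    s≡slope : s ≡ slope x i j
    s≡slope = begin
      s                                          ≡⟨ law s (slope x i j) ⟩
      slope x i j - (slope x i j + s * -1ℤ)      ≡⟨ cong (λ z → slope x i j - (slope x i j + s * z)) (slope-diagonal x i) ⟨
      slope x i j - (slope x i j + s * slope x i i)
        ≡⟨ cong (λ z → slope x i j - z) (shear (h i (not (lookup x i)))) ⟨
      slope x i j - dot (h i (not (lookup x i))) w
        ≡⟨ cong (λ z → slope x i j - z) (h-off (flip x i) (lookup-flip x i) j≢i) ⟩
      slope x i j - 0ℤ                           ≡⟨ ℤ.+-identityʳ (slope x i j) ⟩
      slope x i j                                ∎
      where
      law : ∀ s t → s ≡ t - (t + s * -1ℤ)
      law = solve-∀

  slope-pivot : ∀ x {i j k} → k ≢ i → j ≢ i →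
    slope (flip x i) k j ≡ slope x k j + slope x i j * slope x k i
  slope-pivot x {i} {j} {k} k≢i j≢i = trans
    (cong (λ b → dot (h k (not b)) (u (flip x i) j)) (lookup-flip′ x k≢i))
    (dot-u-flip x j≢i (h k (not (lookup x k))))

  zero-slopes⇒opposite-normals : ∀ x i → (∀ j → j ≢ i → slope x i j ≡ 0ℤ) →
    ∀ w → dot (h i (not (lookup x i))) w ≡ - dot (h i (lookup x i)) w
  zero-slopes⇒opposite-normals x i zeros w = begin
    dot (h i (not (lookup x i))) w             ≡⟨ expand x (h i (not (lookup x i))) w ⟩
    sumℤ (λ k → coord x k w * slope x i k)
      ≡⟨ sum-one i (λ k k≢i → trans (cong (coord x k w *_) (zeros k k≢i)) (ℤ.*-zeroʳ (coord x k w))) ⟩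
    coord x i w * slope x i i                  ≡⟨ cong (coord x i w *_) (slope-diagonal x i) ⟩
    coord x i w * -1ℤ                          ≡⟨ law (coord x i w) ⟩
    - coord x i w                              ∎
    where
    law : ∀ s → s * -1ℤ ≡ - s
    law = solve-∀

  kernel⊆InLin : ∀ i ε w → dot (h i ε) w ≡ 0ℤ → InLin P (proj₁ (facet i ε)) w
  kernel⊆InLin i ε w hw≡0 = subst (InLin P F) (sym w≡)
    (vsum-closed (InLin P F) (InLin-𝟘 P F) (InLin-⊕ P F) (λ k → coord x k w • u x k) term)
    where
    F : Subset (n P)
    F = proj₁ (facet i ε)
    x : Vec Bool d
    x = replicate d ε
    x≡ε : ∀ k → lookup x k ≡ ε
    x≡ε k = lookup-replicate k ε
    w≡ : w ≡ vsum (λ k → coord x k w • u x k)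
    w≡ = dot-ext λ g → trans (expand x g w) (sym (dot-lincomb g (λ k → coord x k w) (u x)))
    term : ∀ k → InLin P F (coord x k w • u x k)
    term k with k ≟ i
    ... | no k≢i = InLin-• P F (coord x k w) (InLin-divide P F (m x k) (m≢0 x k)
      (subst (InLin P F) (edge x k) (InLin-difference P F
        (⇔.from (∈-facet i ε (flip x k)) (trans (lookup-flip′ x (k≢i ∘ sym)) (x≡ε i)))
        (⇔.from (∈-facet i ε x) (x≡ε i)))))
    ... | yes refl = subst (InLin P F)
      (dot-ext λ g → trans (dot-𝟘 g) (sym (trans (dot-• g (coord x k w) (u x k))
        (trans (cong (_* dot g (u x k)) (trans (cong (λ b → dot (h k b) w) (x≡ε k)) hw≡0)) (ℤ.*-zeroˡ (dot g (u x k)))))))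
      (InLin-𝟘 P F)

  facet-LinSub : ∀ i ε ε′ → (∀ w → dot (h i ε′) w ≡ - dot (h i ε) w) →
    LinSub P (proj₁ (facet i ε)) (proj₁ (facet i ε′))
  facet-LinSub i ε ε′ opposite p q p∈ q∈ with pt-surj p | pt-surj q
  ... | y , refl | z , refl = kernel⊆InLin i ε′ (V y ⊖ V z) (begin
    dot (h i ε′) (V y ⊖ V z)                   ≡⟨ opposite (V y ⊖ V z) ⟩
    - dot (h i ε) (V y ⊖ V z)                  ≡⟨ cong -_ (dot-⊖ (h i ε) (V y) (V z)) ⟩
    - (dot (h i ε) (V y) - dot (h i ε) (V z))
      ≡⟨ cong -_ (ℤ.i≡j⇒i-j≡0 (h-const y z (⇔.to (∈-facet i ε y) p∈) (⇔.to (∈-facet i ε z) q∈))) ⟩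
    0ℤ                                         ∎)

  zero-slopes⇒parallel-facets : ∀ x i → (∀ j → j ≢ i → slope x i j ≡ 0ℤ) →
    ∃[ F ] ∃[ G ] (IsFacet P F × IsFacet P G × F ≢ G × Parallel P F G)
  zero-slopes⇒parallel-facets x i zeros =
    proj₁ (facet i ε) , proj₁ (facet i (not ε)) ,
    facet-isFacet i ε , facet-isFacet i (not ε) ,
    (λ F≡G → x∉facet-not i (not ε) x (sym (Bool.not-involutive ε))
      (subst (pt x ∈_) F≡G (⇔.from (∈-facet i ε x) refl))) ,
    facet-LinSub i ε (not ε) opposite ,
    facet-LinSub i (not ε) ε λ w →
      trans (sym (ℤ.neg-involutive (dot (h i ε) w))) (cong -_ (sym (opposite w)))
    where
    ε : Bool
    ε = lookup x i
    opposite : ∀ w → dot (h i (not ε)) w ≡ - dot (h i ε) w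
    opposite = zero-slopes⇒opposite-normals x i zeros

parallel-facets : ∀ {d} (P : PointConfig (suc d)) (L : Labelling P) (star : ∀ x → Stars.Star P L x) →
  (∀ i ε → Facets.Normal P L star i ε) →
  ∃[ F ] ∃[ G ] (IsFacet P F × IsFacet P G × F ≢ G × Parallel P F G)
parallel-facets P L star normal =
  let x = replicate _ false
      i , zeros = zeroRow slope slope-diagonal slope-pivot (λ i → i) (λ eq → eq) x
  in zero-slopes⇒parallel-facets x i zeros
  where open Slopes P L star normal

theorem3p7 : (d : ℕ) → d ≥ 2 → (P : PointConfig d) →
    AllVertices P → IsCombinatorialCube P → IsSmooth P →
    ∃[ F ] ∃[ G ] (IsFacet P F × IsFacet P G × F ≢ G × Parallel P F G)
theorem3p7 (suc _) _ P vertices cube smooth = parallel-facets P L star (Facets.normal P L star)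
  where
  L : Labelling P
  L = labelling P vertices cube
  star : ∀ x → Stars.Star P L x
  star = Stars.star P L smooth
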